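{- For all $n\ge3$, the number of pairwise non-isomorphic graphs among the quotient graphs $Q_R$, $R\in\mathcal C_n^*$, is at least $2^n-2n+1$.
   Context: $S_n$ is the set of permutations of $[n]$ with the weak order (inclusion of inversion sets); a lattice congruence is an equivalence relation compatible with joins and meets. Fences. $]a,b[=\{a+1,\dots,b-1\}$. The fence $f(a,b,L)$, for $1\le a<b\le n$ and $L\subseteq\,]a,b[$, is the set of cover edges joining two permutations that differ by swapping adjacent entries $a,b$, with the values of $L$ left of $a,b$ and those of $]a,b[\setminus L$ to the right. Forcing order: $f(a,b,L)\prec f(c,d,M)$ iff $a\le c<d\le b$, $(a,b)\ne(c,d)$, $M=L\cap\,]c,d[$. Lattice congruences $R$ correspond bijectively to downsets $F_R$ of the forcing order (a cover edge joins equivalent permutations iff it lies in a fence of $F_R$). $R$ is essential if $F_R$ contains no fence $f(a,a+1,\emptyset)$; $\mathcal C_n^*$ is the set of essential congruences. $Q_R$ is the undirected cover graph of $S_n/R$. -}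

module Defs where

open import Data.Nat.Base as ℕ using (ℕ)
open import Data.Fin.Base using (Fin; toℕ; _<_)
open import Data.Fin.Permutation using (Permutation′; _⟨$⟩ʳ_; _⟨$⟩ˡ_)
open import Data.Fin.Subset using (Subset; _∈_; _∉_)
open import Data.Product.Base using (_×_; _,_; ∃; ∃₂)
open import Data.Sum.Base using (_⊎_; inj₁; inj₂; swap; [_,_])
open import Function.Base using (flip)
open import Function.Bundles using (Inverse; _⇔_)
open import Level using (0ℓ)
open import Relation.Binary.Bundles using (Setoid)
open import Relation.Binary.Core using (Rel)
open import Relation.Binary.Definitions
  using (Symmetric; Irreflexive; _Respects₂_)
open import Relation.Binary.PropositionalEquality using (_≡_; _≢_)
open import Relation.Binary.Structures using (IsEquivalence)
open import Relation.Nullary.Negation using (¬_)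

IsJoin : {A : Set} → Rel A 0ℓ → A → A → A → Set
IsJoin _≤_ x y j = x ≤ j × y ≤ j × (∀ z → x ≤ z → y ≤ z → j ≤ z)

IsMeet : {A : Set} → Rel A 0ℓ → A → A → A → Set
IsMeet _≤_ = IsJoin (flip _≤_)

Covers : {A : Set} → Rel A 0ℓ → Rel A 0ℓ
Covers _<′_ x y = x <′ y × ¬ (∃ λ z → x <′ z × z <′ y)

-- The type of vertices is a setoid, so that quotients can be formed.
record Graph : Set₁ where
  field
    vertices : Setoid 0ℓ 0ℓ
  open Setoid vertices public renaming (Carrier to Vertex)
  field
    Adj       : Rel Vertex 0ℓ
    respects  : Adj Respects₂ _≈_
    symmetric : Symmetric Adj
    loopless  : Irreflexive _≈_ Adj

record _≅_ (G H : Graph) : Set where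
  private
    module G = Graph G
    module H = Graph H
  field
    bijection : Inverse G.vertices H.vertices
    adjacency : ∀ u v →
      G.Adj u v ⇔ H.Adj (Inverse.to bijection u) (Inverse.to bijection v)

-- The set [n] is Fin n, so all positions and values are shifted down by one.
-- In the one-line notation of π, the entry at position i is π ⟨$⟩ʳ i,
-- and the value v stands at position π ⟨$⟩ˡ v.
module _ {n : ℕ} where

  -- An inversion is a pair of values, not of positions; this is the version
  -- of the weak order whose covers swap two entries in adjacent positions.
  Inversion : Permutation′ n → Fin n → Fin n → Set
  Inversion π a b = a < b × π ⟨$⟩ˡ b < π ⟨$⟩ˡ a

  infix 4 _⊑_

  _⊑_ : Rel (Permutation′ n) 0ℓ
  σ ⊑ τ = ∀ a b → Inversion σ a b → Inversion τ a b

-- Compatibility is stated for joins and meets as least upper and greatest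
-- lower bounds. Permutations that agree pointwise are automatically related:
-- if σ and σ′ agree pointwise, both are joins of σ with itself.
record Congruence (n : ℕ) : Set₁ where
  field
    Rel≡          : Rel (Permutation′ n) 0ℓ
    isEquivalence : IsEquivalence Rel≡
    join-compat   : ∀ {x x′ y y′ j j′} → Rel≡ x x′ → Rel≡ y y′ →
                    IsJoin _⊑_ x y j → IsJoin _⊑_ x′ y′ j′ → Rel≡ j j′
    meet-compat   : ∀ {x x′ y y′ m m′} → Rel≡ x x′ → Rel≡ y y′ →
                    IsMeet _⊑_ x y m → IsMeet _⊑_ x′ y′ m′ → Rel≡ m m′
  open IsEquivalence isEquivalence public

record Fence (n : ℕ) : Set where
  field
    a b : Fin n
    a<b : a < b
    L   : Subset n
    L⊆  : ∀ {c} → c ∈ L → a < c × c < b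

-- The edge between σ = … a b … and τ = … b a … belongs to the fence f(a,b,L).
record IsEdgeOf {n : ℕ} (f : Fence n) (σ τ : Permutation′ n) : Set where
  open Fence f
  field
    i j      : Fin n
    adjacent : toℕ j ≡ ℕ.suc (toℕ i)
    σi≡a     : σ ⟨$⟩ʳ i ≡ a
    σj≡b     : σ ⟨$⟩ʳ j ≡ b
    τi≡b     : τ ⟨$⟩ʳ i ≡ b
    τj≡a     : τ ⟨$⟩ʳ j ≡ a
    agree    : ∀ k → k ≢ i → k ≢ j → σ ⟨$⟩ʳ k ≡ τ ⟨$⟩ʳ k
    left     : ∀ c → c ∈ L → σ ⟨$⟩ˡ c < i
    right    : ∀ c → a < c → c < b → c ∉ L → j < σ ⟨$⟩ˡ c

module _ {n : ℕ} (R : Congruence n) where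
  private module R = Congruence R

  -- Membership in F_R.
  _∈F : Fence n → Set
  f ∈F = ∀ σ τ → IsEdgeOf f σ τ → R.Rel≡ σ τ

  -- When b = a + 1 the set L is empty, since L ⊆ ]a,b[ = ∅.
  IsEssential : Set
  IsEssential = ∀ (f : Fence n) →
    toℕ (Fence.b f) ≡ ℕ.suc (toℕ (Fence.a f)) → ¬ (f ∈F)

  -- In the quotient S_n/R a permutation stands for its class, and X ≤ Y means
  -- that x ⊑ y for some x in X and y in Y.
  _≤Q_ : Rel (Permutation′ n) 0ℓ
  x ≤Q y = ∃₂ λ x′ y′ → R.Rel≡ x x′ × R.Rel≡ y y′ × x′ ⊑ y′

  _<Q_ : Rel (Permutation′ n) 0ℓ
  x <Q y = x ≤Q y × ¬ R.Rel≡ x y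

  private
    <-resp : ∀ {x x₁ y y₁} → R.Rel≡ x x₁ → R.Rel≡ y y₁ → x <Q y → x₁ <Q y₁
    <-resp p q ((x′ , y′ , r , s , le) , ne) =
      (x′ , y′ , R.trans (R.sym p) r , R.trans (R.sym q) s , le) ,
      λ e → ne (R.trans p (R.trans e (R.sym q)))

    covers-resp : ∀ {x x₁ y y₁} → R.Rel≡ x x₁ → R.Rel≡ y y₁ →
                  Covers _<Q_ x y → Covers _<Q_ x₁ y₁
    covers-resp p q (lt , none) =
      <-resp p q lt ,
      λ (z , l , r) → none (z , <-resp (R.sym p) R.refl l
                              , <-resp R.refl (R.sym q) r)

  AdjQ : Rel (Permutation′ n) 0ℓ
  AdjQ x y = Covers _<Q_ x y ⊎ Covers _<Q_ y x

  private
    adj-resp : ∀ {x x₁ y y₁} → R.Rel≡ x x₁ → R.Rel≡ y y₁ → AdjQ x y → AdjQ x₁ y₁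
    adj-resp p q (inj₁ c) = inj₁ (covers-resp p q c)
    adj-resp p q (inj₂ c) = inj₂ (covers-resp q p c)

  quotientGraph : Graph
  quotientGraph = record
    { vertices  = record { isEquivalence = R.isEquivalence }
    ; Adj       = AdjQ
    ; respects  = (λ q → adj-resp R.refl q) , (λ p → adj-resp p R.refl)
    ; symmetric = swap
    ; loopless  = λ e → [ (λ ((_ , ne) , _) → ne e)
                        , (λ ((_ , ne) , _) → ne (R.sym e)) ]
    }

EssentialCongruence : ℕ → Set₁
EssentialCongruence n = ∃ λ (R : Congruence n) → IsEssential R

Q : ∀ {n} → EssentialCongruence n → Graph
Q (R , _) = quotientGraph R

{-# OPTIONS --safe #-}
module Submission where

-- A congruence of the weak order is determined by its set U of uncontracted
-- arcs, which is closed upwards in the forcing order: x and y are congruent iff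
-- they lie above the same join-irreducibles of arcs in U. This description is
-- compatible with meets. It is compatible with joins because x and y then also
-- lie below the same meet-irreducibles of arcs in U.
--
-- Apart from the fences f(a,a+1,∅) there are 2 ^ n ∸ 2 * n fences. Contracting
-- them one at a time, along a linear extension of the forcing order, gives a
-- chain of essential congruences. Each strictly coarser congruence has fewer
-- classes, so its quotient graph has fewer vertices.

open import Defs
open import Data.Nat.Base using (ℕ; _≤_; _+_; _*_; _∸_; _^_)
open import Data.Fin.Base using (Fin)
open import Data.Product.Base using (Σ-syntax)
open import Relation.Binary.PropositionalEquality using (_≢_)
open import Relation.Nullary.Negation using (¬_)
open import Algebra.Properties.CommutativeSemigroup using (interchange)
open import Data.Bool.Base using (Bool; true; false; if_then_else_)
import Data.Bool.Properties as Bool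
open import Data.Empty using (⊥; ⊥-elim)
open import Data.Fin.Base
  using (zero; suc; toℕ; fromℕ<; opposite; punchOut; funToFin; finToFun)
  renaming (_<_ to _<ᶠ_)
import Data.Fin.Properties as Fin
import Data.Fin.Permutation.Components as PC
open import Data.Fin.Permutation
  using (Permutation′; permutation; transpose; reverse; inverseʳ; _∘ₚ_; _⟨$⟩ʳ_; _⟨$⟩ˡ_)
  renaming (id to idₚ)
open import Data.Fin.Subset using (Subset; ∣_∣; _∈_)
open import Data.Fin.Subset.Properties using (∈⊤; ∣⊤∣≡n; p⊂q⇒∣p∣<∣q∣)
open import Data.Nat.Base using (zero; suc; _<_; z≤n; s≤s; s≤s⁻¹)
open import Data.List.Base using (List; []; _∷_; _++_; length; map; drop)
open import Data.List.Properties using (length-++; length-map)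
open import Data.List.Relation.Unary.All as All using (All; []; _∷_)
import Data.List.Relation.Unary.All.Properties as All
open import Data.List.Relation.Unary.AllPairs as AllPairs using (AllPairs; []; _∷_)
import Data.List.Relation.Unary.AllPairs.Properties as AllPairs
import Data.List.Membership.Propositional as List
open import Data.List.Relation.Unary.Any using (here; there)
open import Data.Nat.Properties
open import Data.Product.Base using (_×_; _,_; ∃; proj₁; proj₂)
open import Data.Sum.Base using (_⊎_; inj₁; inj₂)
open import Data.Vec.Base using (tabulate)
open import Data.Vec.Properties using (lookup∘tabulate; []=⇒lookup; lookup⇒[]=)
open import Function.Base using (_∘_; id) renaming (flip to flipped)
open import Function.Bundles using (Inverse; _⇔_; mk⇔; Equivalence)
open import Function.Definitions using (Injective)
open import Level using (0ℓ)
open import Relation.Binary.Core using (Rel; _⇒_)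
open import Relation.Binary.Definitions using (Tri; tri<; tri≈; tri>)
open import Relation.Binary.Structures using (IsEquivalence; IsStrictTotalOrder)
import Relation.Binary.Construct.Flip.EqAndOrd as Flip
open import Relation.Binary.PropositionalEquality
  using (_≡_; refl; sym; trans; cong; cong₂; subst; subst₂; isEquivalence; module ≡-Reasoning)
open import Relation.Nullary.Decidable using 
  ( Dec; yes; no; does; map′; _×-dec_; _⊎-dec_; dec-true; dec-false
  ; ¬¬-excluded-middle)
open import Relation.Nullary.Negation using (contradiction)
open import Relation.Unary using (Pred)

-- Sorting by a key

-- A missed value could be punched out of the codomain, leaving an injection of `Fin (suc n)` into
-- `Fin n`.
injective⇒surjective : ∀ {n} {f : Fin n → Fin n} → Injective _≡_ _≡_ f →
                       ∀ i → ∃ λ j → f j ≡ i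
injective⇒surjective {suc n} {f} inj i with Fin.any? (λ j → f j Fin.≟ i)
... | yes hit  = hit
... | no  miss =
  ⊥-elim (Fin.<⇒notInjective {f = λ j → punchOut (i≢f j)} (n<1+n n)
            λ eq → inj (Fin.punchOut-injective (i≢f _) (i≢f _) eq))
  where
  i≢f : ∀ j → i ≢ f j
  i≢f j eq = miss (j , sym eq)

-- `f` sends a value to its position, so it becomes the inverse direction `⟨$⟩ˡ`.
fromInjection : ∀ {n} (f : Fin n → Fin n) → Injective _≡_ _≡_ f → Permutation′ n
fromInjection f inj = permutation f⁻¹ f
  (λ j → inj (proj₂ (injective⇒surjective inj (f j))))
  (λ i → proj₂ (injective⇒surjective inj i))
  where
  f⁻¹ : _ → _
  f⁻¹ i = proj₁ (injective⇒surjective inj i)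

Before : ∀ {n} → Permutation′ n → Rel (Fin n) 0ℓ
Before π u v = π ⟨$⟩ˡ u <ᶠ π ⟨$⟩ˡ v

module _ {n : ℕ} (key : Fin n → ℕ) where

  smaller : Fin n → Subset n
  smaller v = tabulate λ w → does (key w <? key v)

  ∈-smaller⁺ : ∀ {w v} → key w < key v → w ∈ smaller v
  ∈-smaller⁺ {w} {v} lt = lookup⇒[]= w (smaller v)
    (trans (lookup∘tabulate _ w) (dec-true (key w <? key v) lt))

  ∈-smaller⁻ : ∀ {w v} → w ∈ smaller v → key w < key v
  ∈-smaller⁻ {w} {v} w∈ with key w <? key v
  ... | yes lt = lt
  ... | no  ≮  = contradiction
    (trans (sym ([]=⇒lookup w∈)) (trans (lookup∘tabulate _ w) (dec-false (key w <? key v) ≮))) λ ()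

  rank : Fin n → Fin n
  rank v = fromℕ< (subst (∣ smaller v ∣ <_) (∣⊤∣≡n n)
    (p⊂q⇒∣p∣<∣q∣ ((λ _ → ∈⊤) , v , ∈⊤ , <-irrefl refl ∘ ∈-smaller⁻)))

  rank-mono : ∀ {u v} → key u < key v → rank u <ᶠ rank v
  rank-mono {u} {v} lt = subst₂ _<_ (sym (Fin.toℕ-fromℕ< _)) (sym (Fin.toℕ-fromℕ< _))
    (p⊂q⇒∣p∣<∣q∣ ( (λ w∈ → ∈-smaller⁺ (<-trans (∈-smaller⁻ w∈) lt))
                 , u , ∈-smaller⁺ lt , <-irrefl refl ∘ ∈-smaller⁻))

  sortBy : Injective _≡_ _≡_ key → ∃ λ π → ∀ {u v} → key u < key v → Before π u v
  sortBy key-inj = fromInjection rank rank-inj , rank-mono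
    where
    rank-inj : Injective _≡_ _≡_ rank
    rank-inj {u} {v} eq with <-cmp (key u) (key v)
    ... | tri< lt _ _ = contradiction eq (Fin.<⇒≢ (rank-mono lt))
    ... | tri≈ _ e _  = key-inj e
    ... | tri> _ _ gt = contradiction (sym eq) (Fin.<⇒≢ (rank-mono gt))

module _ {n : ℕ} (level : Fin n → ℕ) where

  private
    key : Fin n → ℕ
    -- Since `toℕ w` is less than `n`, the level dominates and ties are broken by value: each level
    -- is an increasing block.
    key w = level w * n + toℕ w

    key-level : ∀ {u v} → level u < level v → key u < key v
    key-level {u} {v} lt = begin-strict
      level u * n + toℕ u  <⟨ +-monoʳ-< (level u * n) (Fin.toℕ<n u) ⟩
      level u * n + n      ≡⟨ +-comm (level u * n) n ⟩
      suc (level u) * n    ≤⟨ *-monoˡ-≤ n lt ⟩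
      level v * n          ≤⟨ m≤m+n _ _ ⟩
      level v * n + toℕ v  ∎
      where open ≤-Reasoning

    key-value : ∀ {u v} → level u ≤ level v → u <ᶠ v → key u < key v
    key-value le lt = +-mono-≤-< (*-monoˡ-≤ n le) lt

    key-injective : Injective _≡_ _≡_ key
    key-injective {u} {v} eq with <-cmp (level u) (level v)
    ... | tri< lt _ _ = contradiction eq (<⇒≢ (key-level lt))
    ... | tri> _ _ gt = contradiction (sym eq) (<⇒≢ (key-level gt))
    ... | tri≈ _ e _  = Fin.toℕ-injective
      (+-cancelˡ-≡ (level u * n) _ _ (trans eq (cong (λ l → l * n + toℕ v) (sym e))))

  sortByLevel : Permutation′ n
  sortByLevel = proj₁ (sortBy key key-injective)

  sortByLevel-level : ∀ {u v} → level u < level v → Before sortByLevel u v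
  sortByLevel-level lt = proj₂ (sortBy key key-injective) (key-level lt)

  sortByLevel-inversion : ∀ {u v} → u <ᶠ v → Before sortByLevel v u → level v < level u
  sortByLevel-inversion {u} {v} u<v v≺u with level v <? level u
  ... | yes lt = lt
  ... | no ≮   = contradiction (proj₂ (sortBy key key-injective) (key-value (≮⇒≥ ≮) u<v))
                               (<-asym v≺u)

-- The order of the values in a permutation

module _ {n : ℕ} where

  before-isStrictTotalOrder : (π : Permutation′ n) → IsStrictTotalOrder _≡_ (Before π)
  before-isStrictTotalOrder π = record
    { isStrictPartialOrder = record
      { isEquivalence = isEquivalence
      ; irrefl        = λ { refl → <-irrefl refl }
      ; trans         = <-trans
      ; <-resp-≈      = (λ { refl → id }) , (λ { refl → id })
      }
    ; compare = cmp
    }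
    where
    cmp : ∀ u v → Tri (Before π u v) (u ≡ v) (Before π v u)
    cmp u v with Fin.<-cmp (π ⟨$⟩ˡ u) (π ⟨$⟩ˡ v)
    ... | tri< lt ne ≯ = tri< lt (λ { refl → ne refl }) ≯
    ... | tri> ≮ ne gt = tri> ≮ (λ { refl → ne refl }) gt
    ... | tri≈ ≮ e ≯   =
      tri≈ ≮ (trans (sym (inverseʳ π)) (trans (cong (π ⟨$⟩ʳ_) e) (inverseʳ π))) ≯

  rev : Permutation′ n → Permutation′ n
  rev π = reverse ∘ₚ π

  opposite-anti : ∀ {i j : Fin n} → i <ᶠ j → opposite j <ᶠ opposite i
  opposite-anti {i} {j} i<j = subst₂ _<_ (sym (Fin.opposite-prop j)) (sym (Fin.opposite-prop i))
    (∸-monoʳ-< (s≤s i<j) (Fin.toℕ<n j))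

  rev-before : ∀ π {u v} → Before π u v → Before (rev π) v u
  rev-before π = opposite-anti

-- Arcs

-- An arc encodes the fence f(lo, hi, L), where L is the set of those values
-- strictly between lo and hi at which side is true.
record Arc : Set where
  constructor arc
  field
    lo hi : ℕ
    side  : ℕ → Bool
open Arc

infix 4 _≼_

-- f ≼ g says that f is below g in the forcing order, or equal to it.
record _≼_ (f g : Arc) : Set where
  constructor forces
  field
    lo≤  : lo f ≤ lo g
    ≤hi  : hi g ≤ hi f
    same : ∀ {w} → lo g < w → w < hi g → side f w ≡ side g w
open _≼_

≼-refl : ∀ {f} → f ≼ f
≼-refl = forces ≤-refl ≤-refl λ _ _ → refl

≼-trans : ∀ {f g h} → f ≼ g → g ≼ h → f ≼ h
≼-trans (forces l u s) (forces l′ u′ s′) = forces (≤-trans l l′) (≤-trans u′ u)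
  λ p q → trans (s (≤-<-trans l′ p) (<-≤-trans q u′)) (s′ p q)

true-or-false : ∀ b → b ≡ true ⊎ b ≡ false
true-or-false true  = inj₁ refl
true-or-false false = inj₂ refl

false-or-true : ∀ b → b ≡ false ⊎ b ≡ true
false-or-true true  = inj₂ refl
false-or-true false = inj₁ refl

Inside : Arc → ℕ → Set
Inside f w = lo f < w × w < hi f

module _ {n : ℕ} where

  -- The colours are parameters so that one argument serves join-irreducibles (`false`, `true`) and
  -- meet-irreducibles (`true`, `false`).
  data Low (α : Bool) (f : Arc) (u : Fin n) : Set where
    at-lo  : toℕ u ≡ lo f → Low α f u
    inside : Inside f (toℕ u) → side f (toℕ u) ≡ α → Low α f u

  data High (γ : Bool) (f : Arc) (v : Fin n) : Set where
    at-hi  : toℕ v ≡ hi f → High γ f v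
    inside : Inside f (toℕ v) → side f (toℕ v) ≡ γ → High γ f v

  low? : ∀ α f u → Dec (Low α f u)
  low? α f u = map′ (λ { (inj₁ e) → at-lo e ; (inj₂ (i , e)) → inside i e })
                    (λ { (at-lo e) → inj₁ e ; (inside i e) → inj₂ (i , e) })
    ((toℕ u ≟ lo f) ⊎-dec
      (((lo f <? toℕ u) ×-dec (toℕ u <? hi f)) ×-dec (side f (toℕ u) Bool.≟ α)))

  lo≤low : ∀ {α f u} → Low α f u → lo f ≤ toℕ u
  lo≤low (at-lo e)          = ≤-reflexive (sym e)
  lo≤low (inside (l , _) _) = <⇒≤ l

  high≤hi : ∀ {γ f v} → High γ f v → toℕ v ≤ hi f
  high≤hi (at-hi e)          = ≤-reflexive e
  high≤hi (inside (_ , h) _) = <⇒≤ h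

  Separates : Rel (Fin n) 0ℓ → Bool → Bool → Arc → Set
  Separates _<′_ α γ f = ∀ u v → u <ᶠ v → Low α f u → High γ f v → u <′ v

  -- π is above the join-irreducible permutation of the arc f.
  record Above (π : Permutation′ n) (f : Arc) : Set where
    constructor mkAbove
    field separates : Separates (flipped (Before π)) false true f

  -- π is below the meet-irreducible permutation of the arc f.
  record Below (π : Permutation′ n) (f : Arc) : Set where
    constructor mkBelow
    field separates : Separates (Before π) true false f

  -- If u <₂ v fails for some u < v that f separates, then for a pair with
  -- v − u least, every value between u and v is on the far side of u and v,
  -- so that the opposite of <₂ separates the arc from u to v.
  exchange : ∀ {_<₁_ _<₂_ : Rel (Fin n) 0ℓ} →
             IsStrictTotalOrder _≡_ _<₁_ → IsStrictTotalOrder _≡_ _<₂_ →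
             ∀ {α γ} → (∀ b → b ≡ α ⊎ b ≡ γ) → ∀ {f} →
             (∀ {g} → f ≼ g → Separates (flipped _<₂_) γ α g →
                              Separates (flipped _<₁_) γ α g) →
             Separates _<₁_ α γ f → Separates _<₂_ α γ f
  exchange {_<₁_} {_<₂_} O₁ O₂ {α} {γ} either {f} transfer sep u₀ v₀ =
    λ u<v → go (suc (toℕ v₀)) u<v (m≤n+m (suc (toℕ v₀)) (toℕ u₀))
    where
    module O₁ = IsStrictTotalOrder O₁
    module O₂ = IsStrictTotalOrder O₂

    -- Induction on a strict bound `k` for v - u.
    go : ∀ k {u v} → u <ᶠ v → toℕ v < toℕ u + k → Low α f u → High γ f v → u <₂ v
    go zero {u} u<v bd _ _ = contradiction (subst (_ <_) (+-identityʳ (toℕ u)) bd) (<-asym u<v)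
    go (suc k) {u} {v} u<v bd ulow vhigh with O₂.compare u v
    ... | tri< lt _ _   = lt
    ... | tri≈ _ refl _ = contradiction u<v (<-irrefl refl)
    -- The arc `g` from u to v satisfies `f ≼ g`, so `transfer` applies to it and gives v <₁ u,
    -- against `sep`.
    ... | tri> _ _ v<₂u = contradiction (sep u v u<v ulow vhigh)
                            (O₁.asym (transfer f≼g sep′ u v u<v (at-lo refl) (at-hi refl)))
      where
      bd′ : toℕ v ≤ toℕ u + k
      bd′ = s≤s⁻¹ (subst (toℕ v <_) (+-suc (toℕ u) k) bd)

      g : Arc
      g = arc (toℕ u) (toℕ v) (side f)

      f≼g : f ≼ g
      f≼g = forces (lo≤low ulow) (high≤hi vhigh) λ _ _ → refl

      widen : ∀ {w} → Inside g w → Inside f w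
      widen (l , h) = ≤-<-trans (lo≤low ulow) l , <-≤-trans h (high≤hi vhigh)

      above-u : ∀ {w} → Inside g (toℕ w) → side f (toℕ w) ≡ γ → u <₂ w
      above-u in-g@(l , h) e = go k l (<-≤-trans h bd′) ulow (inside (widen in-g) e)

      below-v : ∀ {w} → Inside g (toℕ w) → side f (toℕ w) ≡ α → w <₂ v
      below-v in-g@(l , h) e = go k h (≤-<-trans bd′ (+-monoˡ-< k l)) (inside (widen in-g) e) vhigh

      low⇒u≤₂ : ∀ {p} → Low γ g p → u ≡ p ⊎ u <₂ p
      low⇒u≤₂ (at-lo e)       = inj₁ (sym (Fin.toℕ-injective e))
      low⇒u≤₂ (inside in-g e) = inj₂ (above-u in-g e)

      high⇒≤₂v : ∀ {q} → High α g q → q ≡ v ⊎ q <₂ v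
      high⇒≤₂v (at-hi e)       = inj₁ (Fin.toℕ-injective e)
      high⇒≤₂v (inside in-g e) = inj₂ (below-v in-g e)

      -- For p low and q high in `g`, the chain is q ≤₂ v <₂ u ≤₂ p; the outer steps are pairs
      -- closer together, covered by induction.
      sep′ : Separates (flipped _<₂_) γ α g
      sep′ p q _ plow qhigh with low⇒u≤₂ plow | high⇒≤₂v qhigh
      ... | inj₁ refl | inj₁ refl = v<₂u
      ... | inj₁ refl | inj₂ lt   = O₂.trans lt v<₂u
      ... | inj₂ lt   | inj₁ refl = O₂.trans v<₂u lt
      ... | inj₂ lt   | inj₂ lt′  = O₂.trans lt′ (O₂.trans v<₂u lt)

  -- Irreducible permutations of an arc

  Above-mono : ∀ {x y f} → x ⊑ y → Above x f → Above y f
  Above-mono x⊑y (mkAbove sep) = mkAbove λ u v u<v l h →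
    proj₂ (x⊑y u v (u<v , sep u v u<v l h))

  Below-anti : ∀ {x y f} → x ⊑ y → Below y f → Below x f
  Below-anti {x} x⊑y (mkBelow sep) = mkBelow sep′
    where
    sep′ : Separates (Before x) true false _
    sep′ u v u<v l h with IsStrictTotalOrder.compare (before-isStrictTotalOrder x) u v
    ... | tri< lt _ _   = lt
    ... | tri≈ _ refl _ = contradiction u<v (<-irrefl refl)
    ... | tri> _ _ gt   = contradiction (sep u v u<v l h) (<-asym (proj₂ (x⊑y u v (u<v , gt))))

  -- The permutation with increasing blocks, first all of High and the values
  -- less than lo, then all of Low and the values greater than hi.
  extremal : ∀ {α γ} → (∀ b → b ≡ α ⊎ b ≡ γ) → α ≢ γ → ∀ f →
             ∃ λ π → Separates (flipped (Before π)) α γ f ×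
                     (∀ u v → u <ᶠ v → Before π v u → Low α f u × High γ f v)
  extremal {α} {γ} either α≢γ f = sortByLevel level , separates′ , inversions
    where
    Late : Fin n → Set
    Late w = hi f < toℕ w ⊎ Low α f w

    late? : ∀ w → Dec (Late w)
    late? w = (hi f <? toℕ w) ⊎-dec low? α f w

    level : Fin n → ℕ
    level w = if does (late? w) then 1 else 0

    late : ∀ {w} → Late w → level w ≡ 1
    late {w} p = cong (if_then 1 else 0) (dec-true (late? w) p)

    early : ∀ {w} → ¬ Late w → level w ≡ 0
    early {w} p = cong (if_then 1 else 0) (dec-false (late? w) p)

    high⇒early : ∀ {u v} → u <ᶠ v → Low α f u → High γ f v → ¬ Late v
    high⇒early _   _ h           (inj₁ hi<v)                = <-irrefl refl (<-≤-trans hi<v (high≤hi h))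
    high⇒early u<v l (at-hi _)   (inj₂ (at-lo v≡lo))        = <-irrefl (sym v≡lo) (≤-<-trans (lo≤low l) u<v)
    high⇒early _   _ (at-hi e)   (inj₂ (inside (_ , lt) _)) = <-irrefl e lt
    high⇒early _   _ (inside (lt , _) _) (inj₂ (at-lo e))   = <-irrefl (sym e) lt
    high⇒early _   _ (inside _ e) (inj₂ (inside _ e′))      = α≢γ (trans (sym e′) e)

    separates′ : Separates (flipped (Before (sortByLevel level))) α γ f
    separates′ u v u<v l h = sortByLevel-level level {v} {u}
      (subst₂ _<_ (sym (early {v} (high⇒early {u} u<v l h))) (sym (late {u} (inj₂ l))) ≤-refl)

    inversions : ∀ u v → u <ᶠ v → Before (sortByLevel level) v u → Low α f u × High γ f v
    inversions u v u<v v≺u with late? u | late? v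
    ... | no  ¬p | _     = contradiction (sortByLevel-inversion level u<v v≺u)
                             λ lt → n≮0 (subst (level v <_) (early ¬p) lt)
    ... | yes p  | yes q = contradiction (sortByLevel-inversion level u<v v≺u)
                             (<-irrefl (trans (late {v} q) (sym (late {u} p))))
    ... | yes (inj₁ hi<u) | no ¬q = contradiction (inj₁ (<-trans hi<u u<v)) ¬q
    ... | yes (inj₂ l)    | no ¬q = l , high
      where
      high : High γ f v
      high with toℕ v ≟ hi f | either (side f (toℕ v))
      ... | yes e  | _      = at-hi e
      ... | no  ne | inj₂ e = inside (≤-<-trans (lo≤low l) u<v , ≤∧≢⇒< (≮⇒≥ (¬q ∘ inj₁)) ne) e
      ... | no  ne | inj₁ e = contradiction
        (inj₂ (inside (≤-<-trans (lo≤low l) u<v , ≤∧≢⇒< (≮⇒≥ (¬q ∘ inj₁)) ne) e)) ¬q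

  -- The inversions of the extremal permutation are exactly the pairs that `Above` requires to be
  -- inverted.
  joinIrreducible : ∀ f → ∃ λ π → Above π f × (∀ {x} → Above x f → π ⊑ x)
  joinIrreducible f with extremal false-or-true (λ ()) f
  ... | π , sep , inversions = π , mkAbove sep , λ where
    (mkAbove sep-x) u v (u<v , v≺u) → let l , h = inversions u v u<v v≺u in u<v , sep-x u v u<v l h

  -- Reversal complements the inversion set, so the non-inversions of `rev π` are exactly the pairs
  -- that `Below` requires to be uninverted.
  meetIrreducible : ∀ f → ∃ λ π → Below π f × (∀ {x} → Below x f → x ⊑ π)
  meetIrreducible f with extremal true-or-false (λ ()) f
  ... | π , sep , inversions =
    rev π , mkBelow (λ u v u<v l h → rev-before π (sep u v u<v l h)) , greatest
    where
    greatest : ∀ {x} → Below x f → x ⊑ rev π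
    greatest (mkBelow sep-x) u v (u<v , v≺u)
      with IsStrictTotalOrder.compare (before-isStrictTotalOrder π) u v
    ... | tri< lt _ _   = u<v , rev-before π lt
    ... | tri≈ _ refl _ = contradiction u<v (<-irrefl refl)
    ... | tri> _ _ gt   = contradiction v≺u
      (let l , h = inversions u v u<v gt in <-asym (sep-x u v u<v l h))

  -- Being above `f` means being above one fixed permutation, so the universal property of the meet
  -- decides it.
  Above-meet : ∀ {x y m f} → IsMeet _⊑_ x y m → Above m f ⇔ (Above x f × Above y f)
  Above-meet {f = f} (m⊑x , m⊑y , greatest) = mk⇔
    (λ above → Above-mono m⊑x above , Above-mono m⊑y above)
    (λ (above-x , above-y) → let π , above-π , least = joinIrreducible f in
      Above-mono (greatest π (least above-x) (least above-y)) above-π)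

  Below-join : ∀ {x y j f} → IsJoin _⊑_ x y j → Below j f ⇔ (Below x f × Below y f)
  Below-join {f = f} (x⊑j , y⊑j , least) = mk⇔
    (λ below → Below-anti x⊑j below , Below-anti y⊑j below)
    (λ (below-x , below-y) → let π , below-π , greatest = meetIrreducible f in
      Below-anti (least π (greatest below-x) (greatest below-y)) below-π)

module _ {n : ℕ} where

  transpose-left : ∀ (a b : Fin n) → PC.transpose a b a ≡ b
  transpose-left a b rewrite dec-true (a Fin.≟ a) refl = refl

  transpose-right : ∀ (a b : Fin n) → PC.transpose a b b ≡ a
  transpose-right a b with b Fin.≟ a
  ... | yes b≡a = b≡a
  ... | no  _ rewrite dec-true (b Fin.≟ b) refl = refl

  transpose-other : ∀ {a b k : Fin n} → k ≢ a → k ≢ b → PC.transpose a b k ≡ k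
  transpose-other {a} {b} {k} k≢a k≢b
    rewrite dec-false (k Fin.≟ a) k≢a | dec-false (k Fin.≟ b) k≢b = refl

-- The congruence of an upset of the forcing order

record Upset : Set₁ where
  field
    Member : Pred Arc 0ℓ
    closed : ∀ {f g} → f ≼ g → Member f → Member g
open Upset

module _ {n : ℕ} (U : Upset) where

  open Equivalence

  record Agree (x y : Permutation′ n) : Set where
    constructor mkAgree
    field agree : ∀ {f} → Member U f → Above x f ⇔ Above y f
  open Agree

  Agree-isEquivalence : IsEquivalence Agree
  Agree-isEquivalence = record
    { refl  = mkAgree λ _ → mk⇔ id id
    ; sym   = λ e → mkAgree λ m → mk⇔ (from (agree e m)) (to (agree e m))
    ; trans = λ e e′ → mkAgree λ m →
        mk⇔ (to (agree e′ m) ∘ to (agree e m)) (from (agree e m) ∘ from (agree e′ m))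
    }

  private
    module Agree-eq = IsEquivalence Agree-isEquivalence

    -- If y were not below `f`, `exchange` would find an arc `g` with `f ≼ g` and y above `g`. As
    -- `g` is still in `U`, x is above `g` too, against x below `f`.
    Agree⇒Below : ∀ {x y} → Agree x y → ∀ {f} → Member U f → Below x f → Below y f
    Agree⇒Below {x} {y} e m (mkBelow sep) = mkBelow
      (exchange (before-isStrictTotalOrder x) (before-isStrictTotalOrder y) true-or-false
        (λ f≼g s → separates (from (agree e (closed U f≼g m)) (mkAbove s))) sep)
      where open Above

    -- The dual use of `exchange`, with both orders reversed; the implication changes direction.
    Below⇒Above : ∀ {x y : Permutation′ n} → (∀ {f} → Member U f → Below y f → Below x f) →
                  ∀ {f} → Member U f → Above x f → Above y f
    Below⇒Above {x} {y} e m (mkAbove sep) = mkAbove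
      (exchange (Flip.isStrictTotalOrder (before-isStrictTotalOrder x))
                (Flip.isStrictTotalOrder (before-isStrictTotalOrder y)) false-or-true
        (λ f≼g s → separates (e (closed U f≼g m) (mkBelow s))) sep)
      where open Below

    Below-resp-join : ∀ {x x′ y y′ j j′ : Permutation′ n} → Agree x x′ → Agree y y′ →
                      IsJoin _⊑_ x y j → IsJoin _⊑_ x′ y′ j′ →
                      ∀ {f} → Member U f → Below j f → Below j′ f
    Below-resp-join p q is is′ m b =
      let b₁ , b₂ = to (Below-join is) b in
      from (Below-join is′) (Agree⇒Below p m b₁ , Agree⇒Below q m b₂)

    Above-resp-meet : ∀ {x x′ y y′ m m′} → Agree x x′ → Agree y y′ →
                      IsMeet _⊑_ x y m → IsMeet _⊑_ x′ y′ m′ →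
                      ∀ {f} → Member U f → Above m f → Above m′ f
    Above-resp-meet p q is is′ f∈U a =
      let a₁ , a₂ = to (Above-meet is) a in
      from (Above-meet is′) (to (agree p f∈U) a₁ , to (agree q f∈U) a₂)

  congruence : Congruence n
  congruence = record
    { Rel≡          = Agree
    ; isEquivalence = Agree-isEquivalence
    -- Joins are controlled by `Below`. Since `Below⇒Above` reverses direction, each half uses the
    -- opposite transfer between the joins.
    ; join-compat   = λ p q is is′ → mkAgree λ f∈U → mk⇔
        (Below⇒Above (Below-resp-join (Agree-eq.sym p) (Agree-eq.sym q) is′ is) f∈U)
        (Below⇒Above (Below-resp-join p q is is′) f∈U)
    ; meet-compat   = λ p q is is′ → mkAgree λ f∈U → mk⇔
        (Above-resp-meet p q is is′ f∈U)
        (Above-resp-meet (Agree-eq.sym p) (Agree-eq.sym q) is′ is f∈U)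
    }

  -- The identity and the transposition of a and a + 1 form an edge of the fence, but only the
  -- transposition is above the arc from a to a + 1.
  essential : (∀ {f} → hi f ≡ suc (lo f) → Member U f) → IsEssential congruence
  essential short f b≡1+a f∈F = <-asym a<b
    (Above.separates (from (agree (f∈F idₚ (transpose a b) edge) (short b≡1+a)) above)
      a b a<b (at-lo refl) (at-hi refl))
    where
    open Fence f

    g : Arc
    g = arc (toℕ a) (toℕ b) (λ _ → true)

    nothing-inside : ∀ {w} {A : Set} → Inside g w → A
    nothing-inside (a<w , w<b) = contradiction (subst (_ <_) b≡1+a w<b) (≤⇒≯ a<w)

    edge : IsEdgeOf f idₚ (transpose a b)
    edge = record
      { i = a ; j = b ; adjacent = b≡1+a ; σi≡a = refl ; σj≡b = refl
      ; τi≡b  = transpose-left a b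
      ; τj≡a  = transpose-right a b
      ; agree = λ _ k≢a k≢b → sym (transpose-other k≢a k≢b)
      ; left  = λ c c∈L → nothing-inside (L⊆ c∈L)
      ; right = λ c a<c c<b _ → nothing-inside (a<c , c<b)
      }

    above : Above (transpose a b) g
    above = mkAbove λ where
      u v u<v (at-lo u≡a) (at-hi v≡b) → subst₂ (λ u v → Before (transpose a b) v u)
        (sym (Fin.toℕ-injective u≡a)) (sym (Fin.toℕ-injective v≡b))
        -- Positions are read from the inverse of `transpose a b`, hence the swapped arguments.
        (subst₂ _<ᶠ_ (sym (transpose-left b a)) (sym (transpose-right b a)) a<b)
      u v u<v (inside i _) _            → nothing-inside i
      u v u<v (at-lo _)    (inside i _) → nothing-inside i

-- A cover edge of each fence

module _ {n : ℕ} (f : Arc) (lo<hi : lo f < hi f) (hi<n : hi f < n) where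

  private
    a b : Fin n
    a = fromℕ< (<-trans lo<hi hi<n)
    b = fromℕ< hi<n

    toℕa : toℕ a ≡ lo f
    toℕa = Fin.toℕ-fromℕ< _

    toℕb : toℕ b ≡ hi f
    toℕb = Fin.toℕ-fromℕ< _

    a<b : a <ᶠ b
    a<b = subst₂ _<_ (sym toℕa) (sym toℕb) lo<hi

    data Block : Set where
      left low high right : Block

    -- Values outside the arc also follow `side f`; the fence leaves their place free, provided they
    -- do not come between a and b.
    block : ℕ → Block
    block w with w ≟ lo f | w ≟ hi f
    ... | yes _ | _     = low
    ... | no _  | yes _ = high
    ... | no _  | no _  = if side f w then left else right

    block-lo : ∀ {w} → w ≡ lo f → block w ≡ low
    block-lo {w} e with w ≟ lo f
    ... | yes _ = refl
    ... | no ne = contradiction e ne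

    block-hi : ∀ {w} → w ≡ hi f → block w ≡ high
    block-hi {w} e with w ≟ lo f | w ≟ hi f
    ... | yes e′ | _     = contradiction (trans (sym e′) e) (<⇒≢ lo<hi)
    ... | no _   | yes _ = refl
    ... | no _   | no ne = contradiction e ne

    block-inside : ∀ {w} → Inside f w → block w ≡ (if side f w then left else right)
    block-inside {w} (l , h) with w ≟ lo f | w ≟ hi f
    ... | yes e | _     = contradiction (sym e) (<⇒≢ l)
    ... | no _  | yes e = contradiction e (<⇒≢ h)
    ... | no _  | no _  = refl

    block-low⁻ : ∀ {w} → block w ≡ low → w ≡ lo f
    block-low⁻ {w} e with w ≟ lo f | w ≟ hi f
    ... | yes e′ | _    = e′
    ... | no _   | no _ = contradiction e (≢low (side f w))
      where
      ≢low : ∀ b → (if b then left else right) ≢ low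
      ≢low true  ()
      ≢low false ()

    block-high⁻ : ∀ {w} → block w ≡ high → w ≡ hi f
    block-high⁻ {w} e with w ≟ lo f | w ≟ hi f
    ... | no _ | yes e′ = e′
    ... | no _ | no _   = contradiction e (≢high (side f w))
      where
      ≢high : ∀ b → (if b then left else right) ≢ high
      ≢high true  ()
      ≢high false ()

    lower upper : Block → ℕ
    lower left  = 0
    lower low   = 1
    lower high  = 2
    lower right = 3
    upper left  = 0
    upper low   = 2
    upper high  = 1
    upper right = 3

    -- The two block orders differ only in exchanging `low` and `high`, which hold just a and b.
    lower⇒upper : ∀ c d → lower c < lower d → upper c < upper d ⊎ (c ≡ low × d ≡ high)
    lower⇒upper low   high  _  = inj₂ (refl , refl)
    lower⇒upper left  low   _  = inj₁ (s≤s z≤n)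
    lower⇒upper left  high  _  = inj₁ (s≤s z≤n)
    lower⇒upper left  right _  = inj₁ (s≤s z≤n)
    lower⇒upper low   right _  = inj₁ ≤-refl
    lower⇒upper high  right _  = inj₁ (s≤s (s≤s z≤n))
    lower⇒upper _     left  ()
    lower⇒upper low   low   (s≤s ())
    lower⇒upper high  low   (s≤s ())
    lower⇒upper right low   (s≤s ())
    lower⇒upper high  high  (s≤s (s≤s ()))
    lower⇒upper right high  (s≤s (s≤s ()))
    lower⇒upper right right (s≤s (s≤s (s≤s ())))

    upper⇒lower : ∀ c d → upper c < upper d → lower c < lower d ⊎ (c ≡ high × d ≡ low)
    upper⇒lower high  low   _  = inj₂ (refl , refl)
    upper⇒lower left  low   _  = inj₁ (s≤s z≤n)
    upper⇒lower left  high  _  = inj₁ (s≤s z≤n)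
    upper⇒lower left  right _  = inj₁ (s≤s z≤n)
    upper⇒lower low   right _  = inj₁ (s≤s (s≤s z≤n))
    upper⇒lower high  right _  = inj₁ ≤-refl
    upper⇒lower _     left  ()
    upper⇒lower high  high  (s≤s ())
    upper⇒lower low   high  (s≤s ())
    upper⇒lower right high  (s≤s ())
    upper⇒lower low   low   (s≤s (s≤s ()))
    upper⇒lower right low   (s≤s (s≤s ()))
    upper⇒lower right right (s≤s (s≤s (s≤s ())))

    lowerLevel upperLevel : Fin n → ℕ
    lowerLevel w = lower (block (toℕ w))
    upperLevel w = upper (block (toℕ w))

  lowerEnd upperEnd : Permutation′ n
  lowerEnd = sortByLevel lowerLevel
  upperEnd = sortByLevel upperLevel

  private
    lowerEnd⊑upperEnd : lowerEnd ⊑ upperEnd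
    lowerEnd⊑upperEnd u v (u<v , v≺u)
      with lower⇒upper (block (toℕ v)) (block (toℕ u)) (sortByLevel-inversion lowerLevel u<v v≺u)
    ... | inj₁ lt = u<v , sortByLevel-level upperLevel {v} {u} lt
    ... | inj₂ (v-low , u-high) =
      contradiction (subst₂ _<_ (block-high⁻ u-high) (block-low⁻ v-low) u<v) (<-asym lo<hi)

    upperEnd-above : Above upperEnd f
    upperEnd-above = mkAbove λ u v _ l h →
      sortByLevel-level upperLevel {v} {u} (≤-<-trans (high-level h) (low-level l))
      where
      low-level : ∀ {u} → Low false f u → 1 < upperLevel u
      low-level (at-lo e) rewrite block-lo e = ≤-refl
      low-level (inside i e) rewrite block-inside i | e = s≤s (s≤s z≤n)

      high-level : ∀ {v} → High true f v → upperLevel v ≤ 1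
      high-level (at-hi e) rewrite block-hi e = ≤-refl
      high-level (inside i e) rewrite block-inside i | e = z≤n

    lowerEnd-not-above : ¬ Above lowerEnd f
    lowerEnd-not-above (mkAbove sep) = <-asym (sep a b a<b (at-lo toℕa) (at-hi toℕb))
      (sortByLevel-level lowerLevel {a} {b} level<)
      where
      level< : lowerLevel a < lowerLevel b
      level< rewrite block-lo toℕa | block-hi toℕb = ≤-refl

    -- The only inversion of upperEnd that lowerEnd lacks is (a , b), and if
    -- the arc g uses it then g crosses from a to b on the same sides as f.
    forced : ∀ {g} → Above upperEnd g → Low false g a → High true g b → g ≼ f
    forced {g} (mkAbove sep) a-low b-high = forces lo-g≤lo-f hi-f≤hi-g same′
      where
      lo-g≤lo-f : lo g ≤ lo f
      lo-g≤lo-f = subst (lo g ≤_) toℕa (lo≤low a-low)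

      hi-f≤hi-g : hi f ≤ hi g
      hi-f≤hi-g = subst (_≤ hi g) toℕb (high≤hi b-high)

      widen : ∀ {w} → Inside f w → Inside g w
      widen (l , h) = ≤-<-trans lo-g≤lo-f l , <-≤-trans h hi-f≤hi-g

      on-side : ∀ (w : Fin n) → Inside f (toℕ w) → side g (toℕ w) ≡ side f (toℕ w)
      on-side w i@(l , h) with side g (toℕ w) in eq-g | side f (toℕ w) in eq-f
      ... | true  | true  = refl
      ... | false | false = refl
      -- Side `true` in `g` would force w before a in `upperEnd`, whereas `f` puts w in the right
      -- block. The next case is symmetric, with b for a.
      ... | true  | false = contradiction
        (sortByLevel-inversion upperLevel a<w (sep a w a<w a-low (inside (widen i) eq-g)))
        λ lt → <-asym lt level<
        where
        a<w : a <ᶠ w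
        a<w = subst (_< toℕ w) (sym toℕa) l
        level< : upperLevel a < upperLevel w
        level< rewrite block-lo toℕa | block-inside i | eq-f = ≤-refl
      ... | false | true = contradiction
        (sortByLevel-inversion upperLevel w<b (sep w b w<b (inside (widen i) eq-g) b-high))
        λ lt → <-asym lt level<
        where
        w<b : w <ᶠ b
        w<b = subst (toℕ w <_) (sym toℕb) h
        level< : upperLevel w < upperLevel b
        level< rewrite block-hi toℕb | block-inside i | eq-f = ≤-refl

      same′ : ∀ {w} → lo f < w → w < hi f → side g w ≡ side f w
      same′ {w} l h = subst (λ w → side g w ≡ side f w) eq
        (on-side (fromℕ< (<-trans h hi<n)) (subst (Inside f) (sym eq) (l , h)))
        where eq = Fin.toℕ-fromℕ< (<-trans h hi<n)

  -- An arc `g` of `U` telling the ends apart would have to use the inversion (a , b). Then `g ≼ f`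
  -- by `forced`, and closure would put `f` in `U`.
  ends-agree : ∀ (U : Upset) → ¬ Member U f → Agree U lowerEnd upperEnd
  ends-agree U f∉U = mkAgree λ g∈U → mk⇔ (Above-mono lowerEnd⊑upperEnd) (descend g∈U)
    where
    descend : ∀ {g} → Member U g → Above upperEnd g → Above lowerEnd g
    descend {g} g∈U ab@(mkAbove sep) = mkAbove sep′
      where
      sep′ : Separates (flipped (Before lowerEnd)) false true g
      sep′ u v u<v l h
        with upper⇒lower (block (toℕ v)) (block (toℕ u))
               (sortByLevel-inversion upperLevel u<v (sep u v u<v l h))
      ... | inj₁ lt = sortByLevel-level lowerLevel {v} {u} lt
      ... | inj₂ (v-high , u-low) = contradiction
        (closed U (forced ab (subst (Low false g) u≡a l) (subst (High true g) v≡b h)) g∈U)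
        f∉U
        where
        u≡a : u ≡ a
        u≡a = Fin.toℕ-injective (trans (block-low⁻ u-low) (sym toℕa))

        v≡b : v ≡ b
        v≡b = Fin.toℕ-injective (trans (block-high⁻ v-high) (sym toℕb))

  ends-disagree : ∀ (U : Upset) → Member U f → ¬ Agree U lowerEnd upperEnd
  ends-disagree U f∈U (mkAgree e) = lowerEnd-not-above (Equivalence.from (e f∈U) upperEnd-above)

-- Counting classes

-- A finite set cannot be mapped injectively from its classes under _≈_ to its
-- classes under a strictly coarser _∼_: each family of k pairwise inequivalent
-- elements under _≈_ would yield k pairwise inequivalent ones under _∼_, and
-- splitting the class of u and v would make them k + 1 under _≈_.
module _ {A : Set} {_∼_ _≈_ : Rel A 0ℓ}
         (∼-equivalence : IsEquivalence _∼_) (≈-equivalence : IsEquivalence _≈_)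
         (≈⇒∼ : _≈_ ⇒ _∼_) {u v : A} (u∼v : u ∼ v) (u≉v : ¬ u ≈ v)
         (h : A → A) (h-injective : ∀ {x y} → h x ∼ h y → x ≈ y)
         {m : ℕ} (code : A → Fin m) (code-injective : ∀ {x y} → code x ≡ code y → x ≈ y)
         where

  private
    module ∼ = IsEquivalence ∼-equivalence
    module ≈ = IsEquivalence ≈-equivalence

    Independent : ∀ {k} → (Fin k → A) → Set
    Independent xs = ∀ {i j} → xs i ≈ xs j → i ≡ j

    cons : ∀ {k} → A → (Fin k → A) → Fin (suc k) → A
    cons x xs zero    = x
    cons x xs (suc i) = xs i

    cons-independent : ∀ {k x} {xs : Fin k → A} →
                       (∀ i → ¬ x ≈ xs i) → Independent xs → Independent (cons x xs)
    cons-independent new ind {zero}  {zero}  _ = refl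
    cons-independent new ind {zero}  {suc j} e = contradiction e (new j)
    cons-independent new ind {suc i} {zero}  e = contradiction (≈.sym e) (new i)
    cons-independent new ind {suc i} {suc j} e = cong suc (ind e)

    images-independent : ∀ {k} {xs : Fin k → A} → Independent xs → Independent (h ∘ xs)
    images-independent ind e = ind (h-injective (≈⇒∼ e))

    grow : ∀ {k} {xs : Fin k → A} → Independent xs →
           Dec (∃ λ i → u ∼ h (xs i)) → ∃ λ (ys : Fin (suc k) → A) → Independent ys
    -- No image lies in the class of u, so u itself is a new element.
    grow {k} {xs} ind (no none) = cons u (h ∘ xs) ,
      cons-independent (λ i e → none (i , ≈⇒∼ e)) (images-independent ind)
    -- The one image in the class of u is replaced by u, and v is added.
    grow {k} {xs} ind (yes (i , u∼hi)) = cons v ys , cons-independent v-new ys-ind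
      where
      ys : Fin k → A
      ys j with j Fin.≟ i
      ... | yes _ = u
      ... | no  _ = h (xs j)

      collide : ∀ {j} → u ∼ h (xs j) → i ≡ j
      collide e = ind (h-injective (∼.trans (∼.sym u∼hi) e))

      v-new : ∀ j → ¬ v ≈ ys j
      v-new j e with j Fin.≟ i
      ... | yes _  = u≉v (≈.sym e)
      ... | no j≢i = j≢i (sym (collide (∼.trans u∼v (≈⇒∼ e))))

      ys-ind : Independent ys
      ys-ind {j} {l} e with j Fin.≟ i | l Fin.≟ i
      ... | yes j≡i | yes l≡i = trans j≡i (sym l≡i)
      ... | yes _   | no l≢i  = contradiction (sym (collide (≈⇒∼ e))) l≢i
      ... | no j≢i  | yes _   = contradiction (sym (collide (≈⇒∼ (≈.sym e)))) j≢i
      ... | no _    | no _    = images-independent ind e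

    -- Whether u is equivalent to an image is not assumed decidable; double negation suffices, as
    -- the goal is a contradiction.
    families : ∀ k → ¬ ¬ (∃ λ (xs : Fin k → A) → Independent xs)
    families zero    none = none ((λ ()) , λ { {()} })
    families (suc k) none = families k λ (_ , ind) →
      ¬¬-excluded-middle λ found? → none (grow ind found?)

  no-injection-to-coarser : ⊥
  no-injection-to-coarser = families (suc m) λ (xs , ind) →
    Fin.<⇒notInjective {f = code ∘ xs} (n<1+n m) λ e → ind (code-injective e)

module _ {n : ℕ} where

  code : Permutation′ n → Fin (n ^ n)
  code π = funToFin (π ⟨$⟩ˡ_)

  code-injective : ∀ {π ρ} → code π ≡ code ρ → ∀ v → π ⟨$⟩ˡ v ≡ ρ ⟨$⟩ˡ v
  code-injective {π} {ρ} e v = trans (sym (Fin.finToFun-funToFin (π ⟨$⟩ˡ_) v))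
    (trans (cong (λ c → finToFun c v) e) (Fin.finToFun-funToFin (ρ ⟨$⟩ˡ_) v))

  code-agree : ∀ (U : Upset) {π ρ} → code π ≡ code ρ → Agree U π ρ
  code-agree U {π} {ρ} e = mkAgree λ _ →
    mk⇔ (Above-mono (⊑-pointwise π ρ (code-injective {π} {ρ} e)))
        (Above-mono (⊑-pointwise ρ π (code-injective {ρ} {π} (sym e))))
    where
    ⊑-pointwise : ∀ (π ρ : Permutation′ n) → (∀ v → π ⟨$⟩ˡ v ≡ ρ ⟨$⟩ˡ v) → π ⊑ ρ
    ⊑-pointwise _ _ eq u v (u<v , v≺u) = u<v , subst₂ _<ᶠ_ (eq v) (eq u) v≺u

  -- More uncontracted arcs give a finer congruence; the edge of `f` shows that it is strictly
  -- finer.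
  no-injection-of-classes : ∀ (U V : Upset) → (∀ {g} → Member U g → Member V g) →
    ∀ f → lo f < hi f → hi f < n → ¬ Member U f → Member V f →
    (h : Permutation′ n → Permutation′ n) → ¬ (∀ {x y} → Agree U (h x) (h y) → Agree V x y)
  no-injection-of-classes U V U⊆V f lo<hi hi<n f∉U f∈V h h-inj =
    no-injection-to-coarser (Agree-isEquivalence U) (Agree-isEquivalence V)
      (λ (mkAgree e) → mkAgree λ m → e (U⊆V m))
      (ends-agree f lo<hi hi<n U f∉U) (ends-disagree f lo<hi hi<n V f∈V)
      h h-inj code (code-agree V)

-- A linear extension of the forcing order

_⋠_ : Rel Arc 0ℓ
f ⋠ g = ¬ (f ≼ g)

prepend : Bool → (ℕ → Bool) → ℕ → Bool
prepend b p zero    = b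
prepend b p (suc i) = p i

patterns : ℕ → List (ℕ → Bool)
patterns zero    = (λ _ → true) ∷ []
patterns (suc s) = map (prepend true) (patterns s) ++ map (prepend false) (patterns s)

length-patterns : ∀ s → length (patterns s) ≡ 2 ^ s
length-patterns zero    = refl
length-patterns (suc s) = begin
  length (map (prepend true) ps ++ map (prepend false) ps)
    ≡⟨ length-++ (map (prepend true) ps) ⟩
  length (map (prepend true) ps) + length (map (prepend false) ps)
    ≡⟨ cong₂ _+_ (length-map _ ps) (length-map _ ps) ⟩
  length ps + length ps
    ≡⟨ cong₂ _+_ (length-patterns s) (trans (length-patterns s) (sym (+-identityʳ _))) ⟩
  2 ^ suc s ∎
  where
  open ≡-Reasoning
  ps = patterns s

-- Only the indices below s encode values inside an arc, so a difference must be witnessed there.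
Differ : ℕ → Rel (ℕ → Bool) 0ℓ
Differ s p q = ∃ λ i → i < s × p i ≢ q i

patterns-differ : ∀ s → AllPairs (Differ s) (patterns s)
patterns-differ zero    = [] ∷ []
patterns-differ (suc s) = AllPairs.++⁺ (AllPairs.map⁺ (AllPairs.map shift (patterns-differ s)))
                                       (AllPairs.map⁺ (AllPairs.map shift (patterns-differ s)))
  (All.map⁺ (All.universal (λ _ → All.map⁺ (All.universal (λ _ → zero , s≤s z≤n , λ ()) _)) _))
  where
  shift : ∀ {b p q} → Differ s p q → Differ (suc s) (prepend b p) (prepend b q)
  shift (i , i<s , ne) = suc i , s≤s i<s , ne

-- The arc that ends at b and has s values inside, provided that s < b.
patternArc : ℕ → ℕ → (ℕ → Bool) → Arc
-- Index i of the pattern is the value b - 1 - i, so i < s describes the inside of the arc.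
patternArc b s p = arc (b ∸ suc s) b λ w → p (b ∸ suc w)

patternArc-⋠ : ∀ b {s} → suc s ≤ b → ∀ {p q} → Differ s p q → patternArc b s p ⋠ patternArc b s q
patternArc-⋠ (suc b) {s} (s≤s s≤b) {p} {q} (i , i<s , ne) (forces _ _ same) =
  ne (subst (λ j → p j ≡ q j) (m∸[m∸n]≡n i≤b) (same (∸-monoʳ-< i<s s≤b) (s≤s (m∸n≤m b i))))
  where
  i≤b : i ≤ b
  i≤b = ≤-trans (<⇒≤ i<s) s≤b

-- Shorter arcs come first. The list starts with one value inside, leaving out the fences
-- f(a,a+1,∅).
arcsTo : ℕ → ℕ → List Arc
arcsTo b zero    = []
arcsTo b (suc d) = arcsTo b d ++ map (patternArc b (suc d)) (patterns (suc d))

-- The geometric sum 2 + 4 + ... + 2^d, stated additively to avoid truncated subtraction.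
length-arcsTo : ∀ b d → length (arcsTo b d) + 2 ≡ 2 ^ suc d
length-arcsTo b zero    = refl
length-arcsTo b (suc d) = begin
  length (arcsTo b d ++ new) + 2          ≡⟨ cong (_+ 2) (length-++ (arcsTo b d)) ⟩
  length (arcsTo b d) + length new + 2    ≡⟨ +-assoc (length (arcsTo b d)) _ 2 ⟩
  length (arcsTo b d) + (length new + 2)  ≡⟨ cong (length (arcsTo b d) +_) (+-comm (length new) 2) ⟩
  length (arcsTo b d) + (2 + length new)  ≡⟨ +-assoc (length (arcsTo b d)) 2 _ ⟨
  length (arcsTo b d) + 2 + length new    ≡⟨ cong₂ _+_ (length-arcsTo b d)
                                               (trans (length-map _ (patterns (suc d))) (length-patterns (suc d))) ⟩
  2 ^ suc d + 2 ^ suc d                   ≡⟨ cong (2 ^ suc d +_) (+-identityʳ _) ⟨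
  2 ^ suc (suc d)                         ∎
  where
  open ≡-Reasoning
  new = map (patternArc b (suc d)) (patterns (suc d))

Bounded : ℕ → ℕ → Pred Arc 0ℓ
Bounded b d f = hi f ≡ b × b ∸ suc d ≤ lo f × suc (lo f) < hi f

arcsTo-bounded : ∀ b d → suc d ≤ b → All (Bounded b d) (arcsTo b d)
arcsTo-bounded b zero    _   = []
arcsTo-bounded b (suc d) d<b = All.++⁺
  (All.map (λ (e , l , g) → e , ≤-trans (∸-monoʳ-≤ b (n≤1+n (suc d))) l , g) (arcsTo-bounded b d (<⇒≤ d<b)))
  (All.map⁺ (All.universal (λ _ → refl , ≤-refl , gap) _))
  where
  gap : suc (b ∸ suc (suc d)) < b
  gap = begin-strict
    suc (b ∸ suc (suc d)) ≡⟨ +-∸-assoc 1 d<b ⟨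
    b ∸ suc d             <⟨ ∸-monoʳ-< {b} (s≤s z≤n) (<⇒≤ d<b) ⟩
    b                     ∎
    where open ≤-Reasoning

-- A shorter arc cannot span a longer one, and arcs of equal length differ at some value inside.
arcsTo-⋠ : ∀ b d → suc d ≤ b → AllPairs _⋠_ (arcsTo b d)
arcsTo-⋠ b zero    _   = []
arcsTo-⋠ b (suc d) d<b = AllPairs.++⁺ (arcsTo-⋠ b d (<⇒≤ d<b))
  (AllPairs.map⁺ (AllPairs.map (patternArc-⋠ b d<b) (patterns-differ (suc d))))
  (All.map (λ (_ , l , _) → All.map⁺ (All.universal (λ _ f≼g →
      <⇒≱ (∸-monoʳ-< {b} ≤-refl d<b) (≤-trans l (lo≤ f≼g))) _))
    (arcsTo-bounded b d (<⇒≤ d<b)))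

arcs : ℕ → List Arc
arcs zero          = []
arcs (suc zero)    = []
arcs (suc (suc b)) = arcs (suc b) ++ arcsTo (suc b) b

length-arcs : ∀ m → length (arcs (suc m)) + 2 * suc m ≡ 2 ^ suc m
length-arcs zero    = refl
length-arcs (suc m) = begin
  length (arcs (suc m) ++ new) + 2 * suc (suc m)
    ≡⟨ cong₂ _+_ (length-++ (arcs (suc m))) (trans (*-suc 2 (suc m)) (+-comm 2 _)) ⟩
  length (arcs (suc m)) + length new + (2 * suc m + 2)
    ≡⟨ interchange +-commutativeSemigroup (length (arcs (suc m))) (length new) (2 * suc m) 2 ⟩
  (length (arcs (suc m)) + 2 * suc m) + (length new + 2)
    ≡⟨ cong₂ _+_ (length-arcs m) (length-arcsTo (suc m) m) ⟩
  2 ^ suc m + 2 ^ suc m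
    ≡⟨ cong (2 ^ suc m +_) (+-identityʳ _) ⟨
  2 ^ suc (suc m) ∎
  where
  open ≡-Reasoning
  new = arcsTo (suc m) m

Encloses : ℕ → Pred Arc 0ℓ
Encloses n f = suc (lo f) < hi f × hi f < n

arcs-enclose : ∀ n → All (Encloses n) (arcs n)
arcs-enclose zero          = []
arcs-enclose (suc zero)    = []
arcs-enclose (suc (suc b)) = All.++⁺
  (All.map (λ (g , lt) → g , m<n⇒m<1+n lt) (arcs-enclose (suc b)))
  (All.map (λ { (refl , _ , g) → g , ≤-refl }) (arcsTo-bounded (suc b) b ≤-refl))

-- Between groups, the earlier arc has the smaller `hi`, while `≼` asks for one at least as large.
arcs-⋠ : ∀ n → AllPairs _⋠_ (arcs n)
arcs-⋠ zero          = []
arcs-⋠ (suc zero)    = []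
arcs-⋠ (suc (suc b)) = AllPairs.++⁺ (arcs-⋠ (suc b)) (arcsTo-⋠ (suc b) b ≤-refl)
  (All.map (λ (_ , lt) → All.map (λ { (refl , _) f≼g → <⇒≱ lt (≤hi f≼g) })
                                 (arcsTo-bounded (suc b) b ≤-refl))
           (arcs-enclose (suc b)))

module _ {A : Set} where

  drop-antitone : ∀ {P : Pred A 0ℓ} {i j} → i ≤ j → ∀ {xs} → All P (drop i xs) → All P (drop j xs)
  drop-antitone {j = j} z≤n ps           = All.drop⁺ j ps
  drop-antitone (s≤s i≤j) {[]}     ps = ps
  drop-antitone (s≤s i≤j) {_ ∷ xs} ps = drop-antitone i≤j {xs} ps

  -- The witness is the entry at index `i`: it survives `drop i`, and all of `drop j` comes after
  -- it.
  first-dropped : ∀ {R : Rel A 0ℓ} {i j xs} → AllPairs R xs → i < j → i < length xs →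
                  ∃ λ x → x List.∈ drop i xs × All (R x) (drop j xs)
  first-dropped {i = zero}  {suc j} (r ∷ _)  _         _         = _ , here refl , All.drop⁺ j r
  first-dropped {i = suc i} {suc j} (_ ∷ rs) (s≤s i<j) (s≤s i<l) = first-dropped rs i<j i<l

-- The arcs of n that are not among the first i are the contracted ones.
uncontracted : ℕ → ℕ → Upset
uncontracted n i = record
  { Member = λ g → All (g ⋠_) (drop i (arcs n))
  ; closed = λ f≼g → All.map (λ f⋠ g≼ → f⋠ (≼-trans f≼g g≼))
  }

-- Each contracted arc spans a listed one, hence has a value inside.
short-uncontracted : ∀ n i {f} → hi f ≡ suc (lo f) → Member (uncontracted n i) f
short-uncontracted n i hi≡ = All.map
  (λ (gap , _) f≼g → <⇒≱ gap (≤-trans (≤hi f≼g) (≤-trans (≤-reflexive hi≡) (s≤s (lo≤ f≼g)))))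
  (All.drop⁺ i (arcs-enclose n))

quotient : ∀ n → ℕ → EssentialCongruence n
quotient n i = congruence (uncontracted n i) , essential (uncontracted n i) (short-uncontracted n i)

-- The arc at index `i` is contracted at stage `i`, and no longer at stage `j`.
no-injection-of-quotients : ∀ {n i j} → i < j → i < length (arcs n) →
  (h : Permutation′ n → Permutation′ n) →
  ¬ (∀ {x y} → Agree (uncontracted n i) (h x) (h y) → Agree (uncontracted n j) x y)
no-injection-of-quotients {n} {i} {j} i<j i<l
  with f , f∈ , later ← first-dropped (arcs-⋠ n) i<j i<l
  with gap , hi<n ← All.lookup (All.drop⁺ i (arcs-enclose n)) f∈ =
  no-injection-of-classes (uncontracted n i) (uncontracted n j) (drop-antitone (<⇒≤ i<j) {arcs n})
    f (<⇒≤ gap) hi<n (λ ⋠s → All.lookup ⋠s f∈ ≼-refl) later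

-- Non-isomorphic quotient graphs

module _ {G H : Graph} (iso : G ≅ H) where
  private
    module G = Graph G
    module H = Graph H
    open module I = Inverse (_≅_.bijection iso) using (to; from)

  ≅-to-injective : ∀ {x y} → to x H.≈ to y → x G.≈ y
  ≅-to-injective e = G.trans (G.sym (I.inverseʳ H.refl)) (I.inverseʳ e)

  ≅-from-injective : ∀ {x y} → from x G.≈ from y → x H.≈ y
  ≅-from-injective e = H.trans (H.sym (I.inverseˡ G.refl)) (I.inverseˡ e)

module _ (n i j : ℕ) where

  -- The quotient with index `j` is the finer one, so the map to exclude runs from it to that with
  -- index `i`; this is `from` here and `to` in the reversed version.
  quotient-≇ : i < j → i < length (arcs n) → ¬ (Q (quotient n i) ≅ Q (quotient n j))
  quotient-≇ i<j i<l iso = no-injection-of-quotients i<j i<l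
    (Inverse.from (_≅_.bijection iso)) (≅-from-injective iso)

  quotient-≇′ : i < j → i < length (arcs n) → ¬ (Q (quotient n j) ≅ Q (quotient n i))
  quotient-≇′ i<j i<l iso = no-injection-of-quotients i<j i<l
    (Inverse.to (_≅_.bijection iso)) (≅-to-injective iso)

mainTheorem9 : ∀ (n : ℕ) → 3 ≤ n →
    Σ[ R ∈ (Fin ((2 ^ n ∸ 2 * n) + 1) → EssentialCongruence n) ]
    (∀ i j → i ≢ j → ¬ (Q (R i) ≅ Q (R j)))
-- The indices run from 0 to `length (arcs n)` inclusive; at the last one nothing is contracted. The
-- smaller of two distinct indices is thus below the length.
mainTheorem9 n@(suc m) _ = quotient n ∘ toℕ , distinct
  where
  below-length : ∀ {i} {k : Fin ((2 ^ n ∸ 2 * n) + 1)} → i < toℕ k → i < length (arcs n)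
  below-length {i} {k} i<k = begin-strict
    i                    <⟨ i<k ⟩
    toℕ k                ≤⟨ s≤s⁻¹ (subst (toℕ k <_) (+-comm _ 1) (Fin.toℕ<n k)) ⟩
    2 ^ n ∸ 2 * n        ≡⟨ cong (_∸ 2 * n) (length-arcs m) ⟨
    length (arcs n) + 2 * n ∸ 2 * n ≡⟨ m+n∸n≡m (length (arcs n)) (2 * n) ⟩
    length (arcs n)      ∎
    where open ≤-Reasoning

  distinct : ∀ i j → i ≢ j → ¬ (Q (quotient n (toℕ i)) ≅ Q (quotient n (toℕ j)))
  distinct i j i≢j with Fin.<-cmp i j
  ... | tri< i<j _ _ = quotient-≇ n (toℕ i) (toℕ j) i<j (below-length {k = j} i<j)
  ... | tri≈ _ i≡j _ = contradiction i≡j i≢j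
  ... | tri> _ _ j<i = quotient-≇′ n (toℕ j) (toℕ i) j<i (below-length {k = i} j<i)
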